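{- The map $\phi: g \mapsto \operatorname{Part} g$ is a bijection from the set of recursive normal permutations of $\mathbb{N}$ onto the set of decidable and permutable equivalence relations on $\mathbb{N}$.
   Context: $\operatorname{Part} g = \{[x]_g : x\in\mathbb{N}\}$ with $[x]_g=\{g^k(x):k\in\mathbb{Z}\}$, viewed as an equivalence relation. An equivalence relation $\Pi$ on $\mathbb{N}$ is decidable if membership of pairs in it is decidable, and permutable if there exists a recursive permutation $f$ with $\operatorname{Part} f = \Pi$. Let $\delta:\mathbb{Z}\to\mathbb{N}$, $\delta(0)=0$, $\delta(k)=2k$ ($k>0$), $\delta(k)=-2k-1$ ($k<0$). A cycle of $g$ of length $n\in\mathbb{N}^+\cup\{\infty\}$ with least element $a_0$ is in normal form if $j\mapsto g^{\delta^{ -1}(j)}(a_0)$ is strictly increasing for $0\le j<n$; $g$ is normal if all its cycles are in normal form. -}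

module Defs where

open import Level using (0ℓ)
open import Data.Nat using (ℕ; zero; suc; _+_; _*_; _≤_; _<_)
open import Data.Integer using (ℤ; +_; -[1+_])
open import Data.Product using (_×_; ∃-syntax)
open import Function.Bundles using (_↔_; Inverse; _⇔_)
open import Relation.Binary.Core using (Rel)
open import Relation.Binary.Definitions using (Decidable)
open import Relation.Binary.Structures using (IsEquivalence)
open import Relation.Binary.PropositionalEquality using (_≡_; _≢_)

-- A permutation of ℕ is a bijection ℕ ↔ ℕ (with its inverse).  Every Agda
-- function is computable, so every such permutation is recursive.
Perm : Set
Perm = ℕ ↔ ℕ

iter : (ℕ → ℕ) → ℕ → ℕ → ℕ
iter f zero    x = x
iter f (suc n) x = f (iter f n x)

pow : Perm → ℤ → ℕ → ℕ
pow g (+ n)      = iter (Inverse.to g) n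
pow g -[1+ n ]   = iter (Inverse.from g) (suc n)

-- Part g, as an equivalence relation:  x ~ y  iff  y ∈ [x]_g = {g^k x : k ∈ ℤ}
Part : Perm → Rel ℕ 0ℓ
Part g x y = ∃[ k ] (pow g k x ≡ y)

_≐_ : Rel ℕ 0ℓ → Rel ℕ 0ℓ → Set
R ≐ S = ∀ x y → R x y ⇔ S x y

Permutable : Rel ℕ 0ℓ → Set
Permutable Π = ∃[ f ] (Part f ≐ Π)

DecPermEquiv : Rel ℕ 0ℓ → Set
DecPermEquiv Π = IsEquivalence Π × Decidable Π × Permutable Π

-- δ : ℤ → ℕ, δ 0 = 0, δ k = 2k (k>0), δ k = -2k-1 (k<0)
δ : ℤ → ℕ
δ (+ n)    = 2 * n
δ -[1+ m ] = 2 * m + 1       -- k = -(m+1):  -2k-1 = 2m+1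

-- "j < length of the cycle of a":  no m with 1 ≤ m ≤ j has g^m a = a
-- (length = least positive period, or ∞ if none)
BelowLength : Perm → ℕ → ℕ → Set
BelowLength g a j = ∀ m → 1 ≤ m → m ≤ j → iter (Inverse.to g) m a ≢ a

LeastInCycle : Perm → ℕ → Set
LeastInCycle g a = ∀ k → a ≤ pow g k a

-- the cycle with least element a₀ is in normal form:
-- j ↦ g^{δ⁻¹ j}(a₀) strictly increasing on 0 ≤ j < n.  Written with δ
-- itself: for integers k, l with δ k < δ l < n, g^k a₀ < g^l a₀.
NormalCycle : Perm → ℕ → Set
NormalCycle g a₀ = ∀ k l → δ k < δ l → BelowLength g a₀ (δ l) → pow g k a₀ < pow g l a₀

Normal : Perm → Set
Normal g = ∀ a₀ → LeastInCycle g a₀ → NormalCycle g a₀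

-- Rank each element x by the number of its class-mates below x; when the equivalence is
-- decidable, so is the rank.  In a normal cycle with least element a₀ the map
-- j ↦ g^(δ⁻¹ j)(a₀) is increasing and exhausts the cycle, so g^k(a₀) has rank δ k.  Hence a
-- normal g is determined by Part g: it sends the element of rank δ k to the one of rank
-- δ (k + 1), wrapping around at the end of a finite class.  Conversely this recipe defines a
-- normal permutation for every decidable permutable Π; a permutation f with Part f = Π is
-- only needed to decide whether a class has more than j elements, which happens iff some
-- f^i(m) with i ≤ j has rank at least j: otherwise the ranks of f^0(m), …, f^j(m) collide,
-- so f has a period at most j on m and the class has at most j elements.  Part g is
-- decidable for normal g because x and y are related iff x = g^(δ⁻¹ i)(z) and
-- y = g^(δ⁻¹ j)(z) with z, i ≤ x and j ≤ y.  Whether a cycle is finite is undecidable, so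
-- the arguments about cycle indices run under double negation; every conclusion drawn from
-- them is decidable.

module Submission where

open import Defs
open import Level using (0ℓ)
open import Data.Nat using (ℕ; NonZero; zero; suc; _+_; _*_; _∸_; _≤_; _<_; z≤n; s≤s; _≤′_; ≤′-refl; ≤′-step)
open import Data.Nat.Properties
open import Data.Nat.DivMod using (_%_; _/_; m≡m%n+[m/n]*n; m%n<n)
open import Data.Nat.Induction using (<-rec)
open import Data.Nat.Tactic.RingSolver using (solve-∀)
open import Data.Integer using (ℤ; +_; -[1+_]; -_)
open import Data.Fin using (toℕ; fromℕ<)
open import Data.Fin.Properties using (pigeonhole; toℕ<n; toℕ-fromℕ<)
open import Data.Product using (_×_; ∃-syntax; _,_; proj₁; proj₂; ∃)
open import Data.Sum using (inj₁; inj₂)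
open import Data.Empty using (⊥; ⊥-elim)
open import Effect.Monad using (RawMonad)
open import Function using (_∘_; id)
open import Function.Bundles using (Inverse; Equivalence; mk⇔; mk↔ₛ′)
open import Relation.Binary.Core using (Rel)
open import Relation.Binary.Definitions using (Decidable; Tri; tri<; tri≈; tri>)
open import Relation.Binary.Structures using (IsEquivalence)
open import Relation.Binary.PropositionalEquality
open import Relation.Nullary using (¬_; Dec; yes; no; _×-dec_)
open import Relation.Nullary.Decidable using (decidable-stable; map′; ¬¬-excluded-middle)
open import Relation.Nullary.Negation using (DoubleNegation; ¬¬-Monad)

open RawMonad (¬¬-Monad {0ℓ}) using (_>>=_; pure)

Minimal : (ℕ → Set) → ℕ → Set
Minimal P m = P m × (∀ {k} → k < m → ¬ P k)

¬¬-minimal : (P : ℕ → Set) → ∀ {n} → P n → DoubleNegation (∃ (Minimal P))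
¬¬-minimal P {n} = <-rec (λ n → P n → DoubleNegation (∃ (Minimal P))) step n
  where
  step : ∀ n → (∀ {k} → k < n → P k → DoubleNegation (∃ (Minimal P))) →
         P n → DoubleNegation (∃ (Minimal P))
  step n below pn = ¬¬-excluded-middle {A = ∃[ k ] (k < n × P k)} >>= λ where
    (yes (k , k<n , pk)) → below k<n pk
    (no none)            → pure (n , pn , λ {k} k<n pk → none (k , k<n , pk))

stepOut : ℤ → ℤ
stepOut (+ n)    = + suc n
stepOut -[1+ n ] = -[1+ suc n ]

δ⁻¹ : ℕ → ℤ
δ⁻¹ zero          = + 0
δ⁻¹ (suc zero)    = -[1+ 0 ]
δ⁻¹ (suc (suc j)) = stepOut (δ⁻¹ j)

δ-stepOut : ∀ k → δ (stepOut k) ≡ 2 + δ k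
δ-stepOut (+ n)    = *-distribˡ-+ 2 1 n
δ-stepOut -[1+ n ] = cong (_+ 1) (*-distribˡ-+ 2 1 n)

δ∘δ⁻¹ : ∀ j → δ (δ⁻¹ j) ≡ j
δ∘δ⁻¹ zero          = refl
δ∘δ⁻¹ (suc zero)    = refl
δ∘δ⁻¹ (suc (suc j)) = trans (δ-stepOut (δ⁻¹ j)) (cong (suc ∘ suc) (δ∘δ⁻¹ j))

δ⁻¹∘δ : ∀ k → δ⁻¹ (δ k) ≡ k
δ⁻¹∘δ (+ zero)       = refl
δ⁻¹∘δ (+ suc n)      = trans (cong δ⁻¹ (δ-stepOut (+ n))) (cong stepOut (δ⁻¹∘δ (+ n)))
δ⁻¹∘δ -[1+ zero ]    = refl
δ⁻¹∘δ -[1+ suc n ]   = trans (cong δ⁻¹ (δ-stepOut -[1+ n ])) (cong stepOut (δ⁻¹∘δ -[1+ n ]))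

δ-[1+n]≡1+δ+n : ∀ n → δ -[1+ n ] ≡ suc (δ (+ n))
δ-[1+n]≡1+δ+n n = +-comm (2 * n) 1

δ+[1+n]≡1+δ-[1+n] : ∀ n → δ (+ suc n) ≡ suc (δ -[1+ n ])
δ+[1+n]≡1+δ-[1+n] n = trans (δ-stepOut (+ n)) (cong suc (sym (δ-[1+n]≡1+δ+n n)))

δ+n≤δ-[1+n] : ∀ n → δ (+ n) ≤ δ -[1+ n ]
δ+n≤δ-[1+n] n = ≤-trans (n≤1+n _) (≤-reflexive (sym (δ-[1+n]≡1+δ+n n)))

δ-[1+n]≤δ+[1+n] : ∀ n → δ -[1+ n ] ≤ δ (+ suc n)
δ-[1+n]≤δ+[1+n] n = ≤-trans (n≤1+n _) (≤-reflexive (sym (δ+[1+n]≡1+δ-[1+n] n)))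

δ+n≤δ+[1+n] : ∀ n → δ (+ n) ≤ δ (+ suc n)
δ+n≤δ+[1+n] n = ≤-trans (δ+n≤δ-[1+n] n) (δ-[1+n]≤δ+[1+n] n)

δ-[1+n]≤δ-[2+n] : ∀ n → δ -[1+ n ] ≤ δ -[1+ suc n ]
δ-[1+n]≤δ-[2+n] n = ≤-trans (δ-[1+n]≤δ+[1+n] n) (δ+n≤δ-[1+n] (suc n))

iter-+ : ∀ (f : ℕ → ℕ) a b x → iter f (a + b) x ≡ iter f a (iter f b x)
iter-+ f zero    b x = refl
iter-+ f (suc a) b x = cong f (iter-+ f a b x)

iter-commute : ∀ (f : ℕ → ℕ) a x → iter f a (f x) ≡ f (iter f a x)
iter-commute f zero    x = refl
iter-commute f (suc a) x = cong f (iter-commute f a x)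

iter-inverse : ∀ {f f′ : ℕ → ℕ} → (∀ x → f (f′ x) ≡ x) → ∀ n x → iter f n (iter f′ n x) ≡ x
iter-inverse         inv zero    x = refl
iter-inverse {f} {f′} inv (suc n) x = begin
  f (iter f n (f′ y))   ≡⟨ iter-commute f n (f′ y) ⟨
  iter f n (f (f′ y))   ≡⟨ cong (iter f n) (inv y) ⟩
  iter f n y            ≡⟨ iter-inverse inv n x ⟩
  x                     ∎
  where
  open ≡-Reasoning
  y = iter f′ n x

1+d+i≤2i⇒2d+1<1+d+i : ∀ d i → suc d + i ≤ 2 * i → 2 * d + 1 < suc d + i
1+d+i≤2i⇒2d+1<1+d+i d i p≤2i = begin-strict
  2 * d + 1       <⟨ n<1+n _ ⟩
  suc (2 * d + 1) ≡⟨ double-suc d ⟩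
  suc d + suc d   ≤⟨ +-monoʳ-≤ (suc d) 1+d≤i ⟩
  suc d + i       ∎
  where
  open ≤-Reasoning
  double-suc : ∀ d → suc (2 * d + 1) ≡ suc d + suc d
  double-suc = solve-∀
  1+d≤i : suc d ≤ i
  1+d≤i = +-cancelʳ-≤ i (suc d) i (≤-trans p≤2i (≤-reflexive (cong (λ n → i + n) (+-identityʳ i))))

module PermProperties (g : Perm) where
  open Inverse g using (to; from; strictlyInverseˡ; strictlyInverseʳ)

  iter-from-to : ∀ n x → iter from n (iter to n x) ≡ x
  iter-from-to = iter-inverse {from} {to} strictlyInverseʳ

  iter-to-injective : ∀ n {x y} → iter to n x ≡ iter to n y → x ≡ y
  iter-to-injective n {x} {y} eq =
    trans (sym (iter-from-to n x)) (trans (cong (iter from n) eq) (iter-from-to n y))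

  part-iter : ∀ n x → Part g x (iter to n x)
  part-iter n x = + n , refl

  part-iter⁻ : ∀ n x → Part g (iter to n x) x
  part-iter⁻ zero    x = + 0 , refl
  part-iter⁻ (suc n) x = -[1+ n ] , iter-from-to (suc n) x

  Meet : ℕ → ℕ → Set
  Meet x y = ∃[ a ] ∃[ b ] (iter to a x ≡ iter to b y)

  part⇒meet : ∀ {x y} → Part g x y → Meet x y
  part⇒meet (+ n , eq)                  = n , 0 , eq
  part⇒meet {x} {y} (-[1+ n ] , eq) = 0 , suc n , (begin
    x                                  ≡⟨ iter-inverse {to} {from} strictlyInverseˡ (suc n) x ⟨
    iter to (suc n) (iter from (suc n) x) ≡⟨ cong (iter to (suc n)) eq ⟩
    iter to (suc n) y                  ∎)
    where
    open ≡-Reasoning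

  meet⇒part : ∀ {x y} → Meet x y → Part g x y
  meet⇒part {x} {y} (a , b , eq) with ≤-total b a
  ... | inj₁ b≤a = + (a ∸ b) , iter-to-injective b (begin
    iter to b (iter to (a ∸ b) x) ≡⟨ iter-+ to b (a ∸ b) x ⟨
    iter to (b + (a ∸ b)) x       ≡⟨ cong (λ n → iter to n x) (m+[n∸m]≡n b≤a) ⟩
    iter to a x                   ≡⟨ eq ⟩
    iter to b y                   ∎)
    where
    open ≡-Reasoning
  ... | inj₂ a≤b = subst (λ w → Part g w y) (sym x≡) (part-iter⁻ (b ∸ a) y)
    where
    open ≡-Reasoning
    x≡ : x ≡ iter to (b ∸ a) y
    x≡ = iter-to-injective a (begin
      iter to a x                   ≡⟨ eq ⟩
      iter to b y                   ≡⟨ cong (λ n → iter to n y) (m+[n∸m]≡n a≤b) ⟨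
      iter to (a + (b ∸ a)) y       ≡⟨ iter-+ to a (b ∸ a) y ⟩
      iter to a (iter to (b ∸ a) y) ∎)

  meet-trans : ∀ {x y z} → Meet x y → Meet y z → Meet x z
  meet-trans {x} {y} {z} (a , b , p) (c , d , q) = c + a , b + d , (begin
    iter to (c + a) x       ≡⟨ iter-+ to c a x ⟩
    iter to c (iter to a x) ≡⟨ cong (iter to c) p ⟩
    iter to c (iter to b y) ≡⟨ iter-+ to c b y ⟨
    iter to (c + b) y       ≡⟨ cong (λ n → iter to n y) (+-comm c b) ⟩
    iter to (b + c) y       ≡⟨ iter-+ to b c y ⟩
    iter to b (iter to c y) ≡⟨ cong (iter to b) q ⟩
    iter to b (iter to d z) ≡⟨ iter-+ to b d z ⟨
    iter to (b + d) z       ∎)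
    where
    open ≡-Reasoning

  part-isEquivalence : IsEquivalence (Part g)
  part-isEquivalence = record
    { refl  = + 0 , refl
    ; sym   = λ p → let (a , b , eq) = part⇒meet p in meet⇒part (b , a , sym eq)
    ; trans = λ p q → meet⇒part (meet-trans (part⇒meet p) (part⇒meet q))
    }

  open IsEquivalence part-isEquivalence public
    renaming (refl to part-refl; sym to part-sym; trans to part-trans)

  Period : ℕ → ℕ → Set
  Period a p = 1 ≤ p × iter to p a ≡ a

  iter-period-* : ∀ {p z} → iter to p z ≡ z → ∀ q → iter to (q * p) z ≡ z
  iter-period-* per zero = refl
  iter-period-* {p} {z} per (suc q) =
    trans (iter-+ to p (q * p) z) (trans (cong (iter to p) (iter-period-* per q)) per)

  iter-period-% : ∀ {p z} .{{_ : NonZero p}} → iter to p z ≡ z → ∀ u → iter to (u % p) z ≡ iter to u z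
  iter-period-% {p} {z} per u = begin
    iter to (u % p) z                         ≡⟨ cong (iter to (u % p)) (iter-period-* {p} per (u / p)) ⟨
    iter to (u % p) (iter to (u / p * p) z)   ≡⟨ iter-+ to (u % p) (u / p * p) z ⟨
    iter to (u % p + u / p * p) z             ≡⟨ cong (λ n → iter to n z) (m≡m%n+[m/n]*n u p) ⟨
    iter to u z                               ∎
    where
    open ≡-Reasoning

  periodic⇒forward : ∀ {p z y} → iter to (suc p) z ≡ z → Part g z y → ∃[ u ] (iter to u z ≡ y)
  periodic⇒forward {p} {z} {y} per pzy with part⇒meet pzy
  ... | a , b , eq = a + b * p , sym (iter-to-injective b (begin
    iter to b y                             ≡⟨ eq ⟨
    iter to a z                             ≡⟨ cong (iter to a) (iter-period-* per b) ⟨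
    iter to a (iter to (b * suc p) z)       ≡⟨ iter-+ to a (b * suc p) z ⟨
    iter to (a + b * suc p) z               ≡⟨ cong (λ n → iter to n z) (rearrange a b p) ⟩
    iter to (b + (a + b * p)) z             ≡⟨ iter-+ to b (a + b * p) z ⟩
    iter to b (iter to (a + b * p) z)       ∎))
    where
    open ≡-Reasoning
    rearrange : ∀ a b p → a + b * suc p ≡ b + (a + b * p)
    rearrange = solve-∀

  periodic-orbit : ∀ {p z y} → iter to (suc p) z ≡ z → Part g z y → ∃[ i ] (i < suc p × iter to i z ≡ y)
  periodic-orbit {p} per pzy =
    let (u , eu) = periodic⇒forward {p} per pzy
    in u % suc p , m%n<n u (suc p) , trans (iter-period-% {suc p} per u) eu

  periodic-iter-as-pow : ∀ {p i z} → i < p → iter to p z ≡ z → ∃[ k ] (δ k < p × pow g k z ≡ iter to i z)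
  periodic-iter-as-pow {p} {i} {z} i<p per with 2 * i <? p
  ... | yes 2i<p = + i , 2i<p , refl
  ... | no 2i≮p  = -[1+ d ] , δk<p , (begin
    iter from (suc d) z                          ≡⟨ cong (iter from (suc d)) per ⟨
    iter from (suc d) (iter to p z)              ≡⟨ cong (λ n → iter from (suc d) (iter to n z)) p≡ ⟩
    iter from (suc d) (iter to (suc d + i) z)    ≡⟨ cong (iter from (suc d)) (iter-+ to (suc d) i z) ⟩
    iter from (suc d) (iter to (suc d) (iter to i z)) ≡⟨ iter-from-to (suc d) (iter to i z) ⟩
    iter to i z                                  ∎)
    where
    open ≡-Reasoning
    d = proj₁ (m≤n⇒∃[o]m+o≡n i<p)
    p≡ : p ≡ suc d + i
    p≡ = trans (sym (proj₂ (m≤n⇒∃[o]m+o≡n i<p))) (cong suc (+-comm i d))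
    δk<p : δ -[1+ d ] < p
    δk<p = subst (δ -[1+ d ] <_) (sym p≡) (1+d+i≤2i⇒2d+1<1+d+i d i (subst (_≤ 2 * i) p≡ (≮⇒≥ 2i≮p)))

  iter-to≡iter-from : ∀ a b {z} → iter to (a + b) z ≡ z → iter to b z ≡ iter from a z
  iter-to≡iter-from a b {z} per = begin
    iter to b z                            ≡⟨ iter-from-to a (iter to b z) ⟨
    iter from a (iter to a (iter to b z))  ≡⟨ cong (iter from a) (iter-+ to a b z) ⟨
    iter from a (iter to (a + b) z)        ≡⟨ cong (iter from a) per ⟩
    iter from a z                          ∎
    where
    open ≡-Reasoning

  belowLength-≤ : ∀ {a i j} → i ≤ j → BelowLength g a j → BelowLength g a i
  belowLength-≤ i≤j bl m 1≤m m≤i = bl m 1≤m (≤-trans m≤i i≤j)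

  minimalPeriod⇒belowLength : ∀ {a p j} → Minimal (Period a) p → j < p → BelowLength g a j
  minimalPeriod⇒belowLength (_ , below) j<p m 1≤m m≤j em = below (≤-<-trans m≤j j<p) (1≤m , em)

  aperiodic⇒belowLength : ∀ {a} → ¬ ∃ (Period a) → ∀ j → BelowLength g a j
  aperiodic⇒belowLength aperiodic j m 1≤m _ em = aperiodic (m , 1≤m , em)

  ¬¬-cycle-index : ∀ {a y} → Part g a y → DoubleNegation (∃[ k ] (BelowLength g a (δ k) × pow g k a ≡ y))
  ¬¬-cycle-index {a} {y} pay = ¬¬-excluded-middle {A = ∃ (Period a)} >>= λ where
    (yes (p , per)) → ¬¬-minimal (Period a) per >>= λ where
      (zero , (() , _) , _)
      (suc p , min@((_ , per₀) , _)) →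
        let (i , i<p , ei) = periodic-orbit per₀ pay
            (k , δk<p , ek) = periodic-iter-as-pow i<p per₀
        in pure (k , minimalPeriod⇒belowLength min δk<p , trans ek ei)
    (no aperiodic) → pure (proj₁ pay , aperiodic⇒belowLength aperiodic _ , proj₂ pay)

  module Enumeration {a₀ : ℕ} (normal : NormalCycle g a₀) where
    enum : ℕ → ℕ
    enum j = pow g (δ⁻¹ j) a₀

    enum-increasing : ∀ {J i j} → BelowLength g a₀ J → i < j → j ≤ J → enum i < enum j
    enum-increasing {i = i} {j} bl i<j j≤J = normal (δ⁻¹ i) (δ⁻¹ j)
      (subst₂ _<_ (sym (δ∘δ⁻¹ i)) (sym (δ∘δ⁻¹ j)) i<j)
      (subst (BelowLength g a₀) (sym (δ∘δ⁻¹ j)) (belowLength-≤ j≤J bl))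

    enum-≥ : ∀ {J} → BelowLength g a₀ J → ∀ j → j ≤ J → j ≤ enum j
    enum-≥ bl zero    _    = z≤n
    enum-≥ bl (suc j) 1+j≤J = ≤-trans (s≤s (enum-≥ bl j (<⇒≤ 1+j≤J))) (enum-increasing bl ≤-refl 1+j≤J)

    enum-δ : ∀ k → enum (δ k) ≡ pow g k a₀
    enum-δ k = cong (λ k → pow g k a₀) (δ⁻¹∘δ k)

    ¬¬-bounded-index : ∀ {x} → Part g a₀ x → DoubleNegation (∃[ i ] (i < suc x × enum i ≡ x))
    ¬¬-bounded-index a₀~x = do
      (k , bl , ek) ← ¬¬-cycle-index a₀~x
      let ei = trans (enum-δ k) ek
      pure (δ k , s≤s (subst (δ k ≤_) ei (enum-≥ bl (δ k) ≤-refl)) , ei)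

  CommonBase : ℕ → ℕ → Set
  CommonBase x y = ∃[ z ] (z < suc x × ∃[ i ] (i < suc x × ∃[ j ] (j < suc y ×
                     pow g (δ⁻¹ i) z ≡ x × pow g (δ⁻¹ j) z ≡ y)))

  commonBase? : ∀ x y → Dec (CommonBase x y)
  commonBase? x y = anyUpTo? (λ z → anyUpTo? (λ i → anyUpTo? (λ j →
    (pow g (δ⁻¹ i) z ≟ x) ×-dec (pow g (δ⁻¹ j) z ≟ y)) (suc y)) (suc x)) (suc x)

  commonBase⇒part : ∀ {x y} → CommonBase x y → Part g x y
  commonBase⇒part (_ , _ , i , _ , j , _ , ex , ey) = part-trans (part-sym (δ⁻¹ i , ex)) (δ⁻¹ j , ey)

  part⇒commonBase : Normal g → ∀ {x y} → Part g x y → CommonBase x y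
  part⇒commonBase normal {x} {y} x~y = decidable-stable (commonBase? x y) (do
    (a₀ , x~a₀ , minimal) ← ¬¬-minimal (Part g x) part-refl
    let least : ∀ {w} → Part g x w → a₀ ≤ w
        least x~w = ≮⇒≥ (λ w<a₀ → minimal w<a₀ x~w)
        open Enumeration (normal a₀ (λ k → least (part-trans x~a₀ (k , refl))))
    (i , i<1+x , ex) ← ¬¬-bounded-index (part-sym x~a₀)
    (j , j<1+y , ey) ← ¬¬-bounded-index (part-trans (part-sym x~a₀) x~y)
    pure (a₀ , s≤s (least part-refl) , i , i<1+x , j , j<1+y , ex , ey))

  part? : Normal g → Decidable (Part g)
  part? normal x y = map′ commonBase⇒part (part⇒commonBase normal) (commonBase? x y)

-- With InRange j meaning j < n for the length n ∈ ℕ⁺ ∪ {∞} of a cycle, next and prev are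
-- k ↦ k ± 1 on the indices k with δ k < n, except that next sends the largest index to the
-- most negative one (and prev conversely).
module CycleSuccessor {InRange : ℕ → Set} (inRange? : ∀ j → Dec (InRange j))
                      (inRange-≤ : ∀ {i j} → i ≤ j → InRange j → InRange i) where

  next : ℤ → ℤ
  next (+ n) with inRange? (δ (+ suc n))
  ... | yes _ = + suc n
  ... | no _ with inRange? (δ -[1+ n ])
  ...   | yes _ = -[1+ n ]
  ...   | no _  = - (+ n)
  next -[1+ zero ]  = + 0
  next -[1+ suc m ] = -[1+ m ]

  prev : ℤ → ℤ
  prev (+ zero) with inRange? (δ -[1+ 0 ])
  ... | yes _ = -[1+ 0 ]
  ... | no _  = + 0
  prev (+ suc n) = + n
  prev -[1+ m ] with inRange? (δ -[1+ suc m ])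
  ... | yes _ = -[1+ suc m ]
  ... | no _ with inRange? (δ (+ suc m))
  ...   | yes _ = + suc m
  ...   | no _  = + m

  inRange-0 : ∀ {j} → InRange j → InRange 0
  inRange-0 = inRange-≤ z≤n

  next-inRange : ∀ k → InRange (δ k) → InRange (δ (next k))
  next-inRange (+ n) r with inRange? (δ (+ suc n))
  ... | yes r′ = r′
  ... | no _ with inRange? (δ -[1+ n ])
  ...   | yes r′ = r′
  next-inRange (+ zero)  r | no _ | no _ = r
  next-inRange (+ suc n) r | no _ | no _ = inRange-≤ (δ-[1+n]≤δ+[1+n] n) r
  next-inRange -[1+ zero ]  r = inRange-0 r
  next-inRange -[1+ suc m ] r = inRange-≤ (δ-[1+n]≤δ-[2+n] m) r

  prev-inRange : ∀ k → InRange (δ k) → InRange (δ (prev k))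
  prev-inRange (+ zero) r with inRange? (δ -[1+ 0 ])
  ... | yes r′ = r′
  ... | no _   = r
  prev-inRange (+ suc n) r = inRange-≤ (δ+n≤δ+[1+n] n) r
  prev-inRange -[1+ m ] r with inRange? (δ -[1+ suc m ])
  ... | yes r′ = r′
  ... | no _ with inRange? (δ (+ suc m))
  ...   | yes r′ = r′
  ...   | no _   = inRange-≤ (δ+n≤δ-[1+n] m) r

  next-+ : ∀ n → InRange (δ (+ suc n)) → next (+ n) ≡ + suc n
  next-+ n r with inRange? (δ (+ suc n))
  ... | yes _ = refl
  ... | no ¬r = ⊥-elim (¬r r)

  prev-0 : InRange 1 → prev (+ 0) ≡ -[1+ 0 ]
  prev-0 r with inRange? (δ -[1+ 0 ])
  ... | yes _ = refl
  ... | no ¬r = ⊥-elim (¬r r)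

  prev-- : ∀ m → InRange (δ -[1+ suc m ]) → prev -[1+ m ] ≡ -[1+ suc m ]
  prev-- m r with inRange? (δ -[1+ suc m ])
  ... | yes _ = refl
  ... | no ¬r = ⊥-elim (¬r r)

  prev∘next : ∀ k → InRange (δ k) → prev (next k) ≡ k
  prev∘next (+ n) r with inRange? (δ (+ suc n))
  ... | yes _ = refl
  ... | no ¬r₁ with inRange? (δ -[1+ n ])
  ...   | yes _ with inRange? (δ -[1+ suc n ])
  ...     | yes r₃ = ⊥-elim (¬r₁ (inRange-≤ (δ+n≤δ-[1+n] (suc n)) r₃))
  ...     | no _ with inRange? (δ (+ suc n))
  ...       | yes r₁ = ⊥-elim (¬r₁ r₁)
  ...       | no _   = refl
  prev∘next (+ zero) r | no _ | no ¬r₂ with inRange? (δ -[1+ 0 ])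
  ... | yes r₂ = ⊥-elim (¬r₂ r₂)
  ... | no _   = refl
  prev∘next (+ suc n) r | no _ | no ¬r₂ with inRange? (δ -[1+ suc n ])
  ... | yes r₂ = ⊥-elim (¬r₂ r₂)
  ... | no _ with inRange? (δ (+ suc n))
  ...   | yes _  = refl
  ...   | no ¬r  = ⊥-elim (¬r r)
  prev∘next -[1+ zero ] r = prev-0 r
  prev∘next -[1+ suc m ] r = prev-- m r

  next∘prev : ∀ k → InRange (δ k) → next (prev k) ≡ k
  next∘prev (+ zero) r with inRange? (δ -[1+ 0 ])
  ... | yes _ = refl
  ... | no ¬r₁ with inRange? (δ (+ 1))
  ...   | yes r₂ = ⊥-elim (¬r₁ (inRange-≤ (δ-[1+n]≤δ+[1+n] 0) r₂))
  ...   | no _ with inRange? (δ -[1+ 0 ])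
  ...     | yes r₁ = ⊥-elim (¬r₁ r₁)
  ...     | no _   = refl
  next∘prev (+ suc n) r = next-+ n r
  next∘prev -[1+ m ] r with inRange? (δ -[1+ suc m ])
  ... | yes _ = refl
  ... | no ¬r₁ with inRange? (δ (+ suc m))
  ...   | yes _ with inRange? (δ (+ suc (suc m)))
  ...     | yes r₂ = ⊥-elim (¬r₁ (inRange-≤ (δ-[1+n]≤δ+[1+n] (suc m)) r₂))
  ...     | no _ with inRange? (δ -[1+ suc m ])
  ...       | yes r₁ = ⊥-elim (¬r₁ r₁)
  ...       | no _   = refl
  next∘prev -[1+ m ] r | no _ | no ¬r₂ with inRange? (δ (+ suc m))
  ... | yes r₂ = ⊥-elim (¬r₂ r₂)
  ... | no _ with inRange? (δ -[1+ m ])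
  ...   | yes _ = refl
  ...   | no ¬r = ⊥-elim (¬r r)

module Ranks (Π : Rel ℕ 0ℓ) (isEquivalence : IsEquivalence Π) (Π? : Decidable Π) where
  open IsEquivalence isEquivalence renaming (refl to Π-refl; sym to Π-sym; trans to Π-trans)

  count : ℕ → ℕ → ℕ
  count x zero = 0
  count x (suc b) with Π? x b
  ... | yes _ = suc (count x b)
  ... | no _  = count x b

  count-suc : ∀ {x b} → Π x b → count x (suc b) ≡ suc (count x b)
  count-suc {x} {b} x~b with Π? x b
  ... | yes _  = refl
  ... | no x≁b = ⊥-elim (x≁b x~b)

  count-cong : ∀ {x y} → Π x y → ∀ b → count x b ≡ count y b
  count-cong x~y zero = refl
  count-cong {x} {y} x~y (suc b) with Π? x b | Π? y b
  ... | yes _   | yes _   = cong suc (count-cong x~y b)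
  ... | no _    | no _    = count-cong x~y b
  ... | yes x~b | no y≁b  = ⊥-elim (y≁b (Π-trans (Π-sym x~y) x~b))
  ... | no x≁b  | yes y~b = ⊥-elim (x≁b (Π-trans x~y y~b))

  count-≤-suc : ∀ x b → count x b ≤ count x (suc b)
  count-≤-suc x b with Π? x b
  ... | yes _ = n≤1+n _
  ... | no _  = ≤-refl

  count-mono : ∀ x {b c} → b ≤ c → count x b ≤ count x c
  count-mono x = mono′ ∘ ≤⇒≤′
    where
    mono′ : ∀ {b c} → b ≤′ c → count x b ≤ count x c
    mono′ ≤′-refl             = ≤-refl
    mono′ (≤′-step {c} b≤′c) = ≤-trans (mono′ b≤′c) (count-≤-suc x c)

  count-witness : ∀ x b {r} → r < count x b → ∃[ z ] (z < b × Π x z × count x z ≡ r)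
  count-witness x (suc b) r< with Π? x b
  count-witness x (suc b) r< | no _ =
    let (z , z<b , x~z , e) = count-witness x b r< in z , m<n⇒m<1+n z<b , x~z , e
  count-witness x (suc b) r< | yes x~b with m≤n⇒m<n∨m≡n (<⇒≤pred r<)
  ... | inj₁ r<c = let (z , z<b , x~z , e) = count-witness x b r<c in z , m<n⇒m<1+n z<b , x~z , e
  ... | inj₂ refl = b , ≤-refl , x~b , refl

  rank : ℕ → ℕ
  rank x = count x x

  rank-count : ∀ {x y} → Π x y → rank y ≡ count x y
  rank-count {x} {y} x~y = sym (count-cong x~y y)

  rank-increasing : ∀ {x y z} → Π x y → Π x z → y < z → rank y < rank z
  rank-increasing {x} {y} {z} x~y x~z y<z = subst₂ _<_ (sym (rank-count x~y)) (sym (rank-count x~z))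
    (subst (_≤ count x z) (count-suc x~y) (count-mono x y<z))

  rank-mono : ∀ {x y z} → Π x y → Π x z → y ≤ z → rank y ≤ rank z
  rank-mono x~y x~z y≤z with m≤n⇒m<n∨m≡n y≤z
  ... | inj₁ y<z = <⇒≤ (rank-increasing x~y x~z y<z)
  ... | inj₂ refl = ≤-refl

  rank-cancel-< : ∀ {x y z} → Π x y → Π x z → rank y < rank z → y < z
  rank-cancel-< x~y x~z r< = ≰⇒> (λ z≤y → <⇒≱ r< (rank-mono x~z x~y z≤y))

  rank-injective : ∀ {x y z} → Π x y → Π x z → rank y ≡ rank z → y ≡ z
  rank-injective {y = y} {z} x~y x~z r≡ with <-cmp y z
  ... | tri< y<z _ _ = ⊥-elim (<-irrefl r≡ (rank-increasing x~y x~z y<z))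
  ... | tri≈ _ y≡z _ = y≡z
  ... | tri> _ _ z<y = ⊥-elim (<-irrefl (sym r≡) (rank-increasing x~z x~y z<y))

  rank-lower : ∀ {x y r} → Π x y → r < rank y → ∃[ z ] (z < y × Π x z × rank z ≡ r)
  rank-lower {x} {y} x~y r<rank with count-witness x y (subst (_ <_) (rank-count x~y) r<rank)
  ... | z , z<y , x~z , e = z , z<y , x~z , trans (rank-count x~z) e

  -- HasRank m j: the class of m has more than j elements.
  HasRank : ℕ → ℕ → Set
  HasRank m j = ∃[ y ] (Π m y × rank y ≡ j)

  hasRank-≥ : ∀ {m y j} → Π m y → j ≤ rank y → HasRank m j
  hasRank-≥ {y = y} m~y j≤r with m≤n⇒m<n∨m≡n j≤r
  ... | inj₁ j<r = let (z , _ , m~z , e) = rank-lower m~y j<r in z , m~z , e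
  ... | inj₂ refl = y , m~y , refl

  hasRank-≤ : ∀ {m i j} → i ≤ j → HasRank m j → HasRank m i
  hasRank-≤ i≤j (y , m~y , refl) = hasRank-≥ m~y i≤j

  iter-closed : ∀ {f} → (∀ x → Π x (f x)) → ∀ n x → Π x (iter f n x)
  iter-closed f-closed zero    x = Π-refl
  iter-closed f-closed (suc n) x = Π-trans (iter-closed f-closed n x) (f-closed _)

  pow-closed : ∀ h → (∀ x → Π x (Inverse.to h x)) → (∀ x → Π x (Inverse.from h x)) →
               ∀ k x → Π x (pow h k x)
  pow-closed h to-closed from-closed (+ n)    = iter-closed to-closed n
  pow-closed h to-closed from-closed -[1+ n ] = iter-closed from-closed (suc n)

  module Permuting (h : Perm) (h-part : Part h ≐ Π) where
    open Inverse h using (to)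
    open PermProperties h

    part⇒Π : ∀ {x y} → Part h x y → Π x y
    part⇒Π {x} {y} = Equivalence.to (h-part x y)

    Π⇒part : ∀ {x y} → Π x y → Part h x y
    Π⇒part {x} {y} = Equivalence.from (h-part x y)

    iter-class : ∀ i m → Π m (iter to i m)
    iter-class i m = part⇒Π (part-iter i m)

    pigeonhole-period : ∀ {m J} → (∀ i → i < suc J → rank (iter to i m) < J) →
                        ∃[ d ] (1 ≤ d × d ≤ J × iter to d m ≡ m)
    pigeonhole-period {m} {J} ranks<J with pigeonhole (n<1+n J) (λ i → fromℕ< (ranks<J (toℕ i) (toℕ<n i)))
    ... | i , j , i<j , same =
          toℕ j ∸ toℕ i , m<n⇒0<n∸m i<j , ≤-trans (m∸n≤m (toℕ j) (toℕ i)) (<⇒≤pred (toℕ<n j)) ,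
          iter-to-injective a (begin
            iter to a (iter to (b ∸ a) m) ≡⟨ iter-+ to a (b ∸ a) m ⟨
            iter to (a + (b ∸ a)) m       ≡⟨ cong (λ n → iter to n m) (m+[n∸m]≡n (<⇒≤ i<j)) ⟩
            iter to b m                   ≡⟨ collision ⟨
            iter to a m                   ∎)
      where
      open ≡-Reasoning
      a = toℕ i
      b = toℕ j
      collision : iter to a m ≡ iter to b m
      collision = rank-injective (iter-class a m) (iter-class b m)
        (trans (sym (toℕ-fromℕ< _)) (trans (cong toℕ same) (toℕ-fromℕ< _)))

    belowLength⇒rank-reached : ∀ {m J} → BelowLength h m J → ∃[ i ] (i < suc J × J ≤ rank (iter to i m))
    belowLength⇒rank-reached {m} {J} bl with anyUpTo? (λ i → J ≤? rank (iter to i m)) (suc J)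
    ... | yes reached = reached
    ... | no unreached =
      let (d , 1≤d , d≤J , per) = pigeonhole-period (λ i i<1+J → ≰⇒> (λ J≤r → unreached (i , i<1+J , J≤r)))
      in ⊥-elim (bl d 1≤d d≤J per)

    belowLength⇒hasRank : ∀ {m J} → BelowLength h m J → HasRank m J
    belowLength⇒hasRank {m} bl =
      let (i , _ , J≤r) = belowLength⇒rank-reached bl in hasRank-≥ (iter-class i m) J≤r

    hasRank⇒rank-reached : ∀ {m J} → HasRank m J → ∃[ i ] (i < suc J × J ≤ rank (iter to i m))
    hasRank⇒rank-reached {m} {J} (y , m~y , ry)
      with anyUpTo? (λ d → (1 ≤? d) ×-dec (iter to d m ≟ m)) (suc J)
    ... | yes (zero , _ , () , _)
    ... | yes (suc p , 1+p<1+J , _ , per) =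
      let (i , i<1+p , ei) = periodic-orbit per (Π⇒part m~y)
      in i , <-trans i<1+p 1+p<1+J , ≤-reflexive (sym (trans (cong rank ei) ry))
    ... | no aperiodic = belowLength⇒rank-reached (λ d 1≤d d≤J per → aperiodic (d , s≤s d≤J , 1≤d , per))

    hasRank? : ∀ m j → Dec (HasRank m j)
    hasRank? m j = map′ (λ (i , _ , j≤r) → hasRank-≥ (iter-class i m) j≤r) hasRank⇒rank-reached
                        (anyUpTo? (λ i → j ≤? rank (iter to i m)) (suc j))

    rank0⇒leastInCycle : ∀ {a} → rank a ≡ 0 → LeastInCycle h a
    rank0⇒leastInCycle {a} r0 k = ≮⇒≥ (λ pk<a → n≮0 (subst (rank (pow h k a) <_) r0
      (rank-increasing (part⇒Π (k , refl)) Π-refl pk<a)))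

    leastInCycle⇒rank0 : ∀ {a} → LeastInCycle h a → rank a ≡ 0
    leastInCycle⇒rank0 {a} least = n≤0⇒n≡0 (≮⇒≥ λ 0<r →
      let (z , z<a , a~z , _) = rank-lower Π-refl 0<r
          (k , ek) = Π⇒part a~z
      in <⇒≱ z<a (subst (a ≤_) ek (least k)))

  module Classes (f : Perm) (f-part : Part f ≐ Π) where
    open Permuting f f-part using (hasRank?)

    module Successor (m : ℕ) = CycleSuccessor (hasRank? m) hasRank-≤
    open Successor using (next; prev)

    base : ℕ → ℕ
    base x = proj₁ (hasRank-≥ {x} Π-refl z≤n)

    base-class : ∀ x → Π x (base x)
    base-class x = proj₁ (proj₂ (hasRank-≥ {x} Π-refl z≤n))

    base-rank : ∀ x → rank (base x) ≡ 0
    base-rank x = proj₂ (proj₂ (hasRank-≥ {x} Π-refl z≤n))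

    base-cong : ∀ {x y} → Π x y → base x ≡ base y
    base-cong {x} {y} x~y =
      rank-injective (base-class x) (Π-trans x~y (base-class y)) (trans (base-rank x) (sym (base-rank y)))

    base-rank0 : ∀ {x} → rank x ≡ 0 → base x ≡ x
    base-rank0 {x} r0 = rank-injective (base-class x) Π-refl (trans (base-rank x) (sym r0))

    index : ℕ → ℤ
    index x = δ⁻¹ (rank x)

    index-inRange : ∀ x → HasRank (base x) (δ (index x))
    index-inRange x = x , Π-sym (base-class x) , sym (δ∘δ⁻¹ (rank x))

    index-δ : ∀ {x k} → rank x ≡ δ k → index x ≡ k
    index-δ {k = k} r≡ = trans (cong δ⁻¹ r≡) (δ⁻¹∘δ k)

    module Lift (s : ℕ → ℤ → ℤ) (s-inRange : ∀ m k → HasRank m (δ k) → HasRank m (δ (s m k))) where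
      lift : ℕ → ℕ
      lift x = proj₁ (s-inRange (base x) (index x) (index-inRange x))

      lift-class : ∀ x → Π x (lift x)
      lift-class x =
        Π-trans (base-class x) (proj₁ (proj₂ (s-inRange (base x) (index x) (index-inRange x))))

      lift-rank : ∀ x → rank (lift x) ≡ δ (s (base x) (index x))
      lift-rank x = proj₂ (proj₂ (s-inRange (base x) (index x) (index-inRange x)))

      lift-at : ∀ {m y k} → rank m ≡ 0 → Π m y → rank y ≡ δ k → rank (lift y) ≡ δ (s m k)
      lift-at {m} {y} r0 m~y ry = trans (lift-rank y)
        (cong₂ (λ b k → δ (s b k)) (trans (sym (base-cong m~y)) (base-rank0 r0)) (index-δ {y} ry))

    lift-inverse : ∀ {s s′} s-inRange s′-inRange → (∀ m k → HasRank m (δ k) → s′ m (s m k) ≡ k) →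
                   ∀ x → Lift.lift s′ s′-inRange (Lift.lift s s-inRange x) ≡ x
    lift-inverse {s} {s′} s-inRange s′-inRange s′∘s x =
      rank-injective (Π-trans (S.lift-class x) (S′.lift-class (S.lift x))) Π-refl (begin
        rank (S′.lift (S.lift x))              ≡⟨ S′.lift-at (base-rank x) base~sx (S.lift-rank x) ⟩
        δ (s′ (base x) (s (base x) (index x))) ≡⟨ cong δ (s′∘s (base x) (index x) (index-inRange x)) ⟩
        δ (index x)                            ≡⟨ δ∘δ⁻¹ (rank x) ⟩
        rank x                                 ∎)
      where
      open ≡-Reasoning
      module S  = Lift s s-inRange
      module S′ = Lift s′ s′-inRange
      base~sx : Π (base x) (S.lift x)
      base~sx = Π-trans (Π-sym (base-class x)) (S.lift-class x)

    module Next = Lift next (Successor.next-inRange)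
    module Prev = Lift prev (Successor.prev-inRange)

    G : Perm
    G = mk↔ₛ′ Next.lift Prev.lift
      (lift-inverse {prev} {next} Successor.prev-inRange Successor.next-inRange Successor.next∘prev)
      (lift-inverse {next} {prev} Successor.next-inRange Successor.prev-inRange Successor.prev∘next)

    G-pow-class : ∀ k x → Π x (pow G k x)
    G-pow-class = pow-closed G Next.lift-class Prev.lift-class

    G-pow-rank : ∀ {m} → rank m ≡ 0 → ∀ k → HasRank m (δ k) → rank (pow G k m) ≡ δ k
    G-pow-rank r0 (+ zero) _ = r0
    G-pow-rank {m} r0 (+ suc n) r = trans
      (Next.lift-at {k = + n} r0 (G-pow-class (+ n) m)
        (G-pow-rank r0 (+ n) (hasRank-≤ (δ+n≤δ+[1+n] n) r)))
      (cong δ (Successor.next-+ m n r))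
    G-pow-rank {m} r0 -[1+ zero ] r =
      trans (Prev.lift-at {k = + 0} r0 Π-refl r0) (cong δ (Successor.prev-0 m r))
    G-pow-rank {m} r0 -[1+ suc n ] r = trans
      (Prev.lift-at {k = -[1+ n ]} r0 (G-pow-class -[1+ n ] m)
        (G-pow-rank r0 -[1+ n ] (hasRank-≤ (δ-[1+n]≤δ-[2+n] n) r)))
      (cong δ (Successor.prev-- m n r))

    G-reaches : ∀ x → Part G (base x) x
    G-reaches x = index x , rank-injective (G-pow-class (index x) (base x)) (Π-sym (base-class x))
      (trans (G-pow-rank (base-rank x) (index x) (index-inRange x)) (δ∘δ⁻¹ (rank x)))

    G-part : Part G ≐ Π
    G-part x y = mk⇔ (λ (k , e) → subst (Π x) e (G-pow-class k x)) λ x~y →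
      part-trans (part-sym (G-reaches x)) (subst (λ b → Part G b y) (sym (base-cong x~y)) (G-reaches y))
      where
      open PermProperties G using (part-sym; part-trans)

    G-normal : Normal G
    G-normal a₀ least k l δk<δl bl = rank-cancel-< (G-pow-class k a₀) (G-pow-class l a₀)
      (subst₂ _<_ (sym (G-pow-rank r0 k k-inRange)) (sym (G-pow-rank r0 l l-inRange)) δk<δl)
      where
      open Permuting G G-part using (leastInCycle⇒rank0; belowLength⇒hasRank)
      r0 = leastInCycle⇒rank0 least
      l-inRange = belowLength⇒hasRank bl
      k-inRange = hasRank-≤ (<⇒≤ δk<δl) l-inRange

    module Uniqueness (h : Perm) (h-normal : Normal h) (h-part : Part h ≐ Π) where
      open Inverse h using (to; strictlyInverseˡ)
      open PermProperties h using (¬¬-cycle-index; module Enumeration; belowLength-≤; iter-to≡iter-from)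
      open Permuting h h-part using (part⇒Π; Π⇒part; belowLength⇒hasRank; rank0⇒leastInCycle)

      module AtBase {m} (r0 : rank m ≡ 0) where
        open Enumeration (h-normal m (rank0⇒leastInCycle r0))

        enum-class : ∀ j → Π m (enum j)
        enum-class j = part⇒Π (δ⁻¹ j , refl)

        enum-mono : ∀ {J i j} → BelowLength h m J → i ≤ j → j ≤ J → enum i ≤ enum j
        enum-mono bl i≤j j≤J with m≤n⇒m<n∨m≡n i≤j
        ... | inj₁ i<j = <⇒≤ (enum-increasing bl i<j j≤J)
        ... | inj₂ refl = ≤-refl

        -- A class-mate z of rank 1 + j below enum (1 + j) would be enum (δ k) for some index k, and
        -- each position of δ k relative to 1 + j contradicts either rank z or z < enum (1 + j).
        enum-rank-≤ : ∀ {J j} → BelowLength h m J → j < J → rank (enum j) ≡ j →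
                      rank (enum (suc j)) ≤ suc j
        enum-rank-≤ {J} {j} bl j<J rj = ≮⇒≥ λ 1+j<r →
          let (z , z<e , m~z , rz) = rank-lower (enum-class (suc j)) 1+j<r
          in ¬¬-cycle-index (Π⇒part m~z) λ (k , blk , ek) →
            impossible {z} {k} (trans (sym ek) (sym (enum-δ k))) blk rz z<e (<-cmp (δ k) (suc j))
          where
          impossible : ∀ {z k} → z ≡ enum (δ k) → BelowLength h m (δ k) → rank z ≡ suc j →
                       z < enum (suc j) → Tri (δ k < suc j) (δ k ≡ suc j) (suc j < δ k) → ⊥
          impossible {k = k} refl _ rz _ (tri< δk<1+j _ _) = <-irrefl rz (s≤s (subst (rank (enum (δ k)) ≤_)
            rj (rank-mono (enum-class (δ k)) (enum-class j) (enum-mono bl (<⇒≤pred δk<1+j) (<⇒≤ j<J)))))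
          impossible refl _ _ z<e (tri≈ _ δk≡1+j _) = <-irrefl (cong enum δk≡1+j) z<e
          impossible refl blk _ z<e (tri> _ _ 1+j<δk) = <-asym z<e (enum-increasing blk 1+j<δk ≤-refl)

        enum-rank : ∀ {J} → BelowLength h m J → ∀ j → j ≤ J → rank (enum j) ≡ j
        enum-rank bl zero    _     = r0
        enum-rank bl (suc j) 1+j≤J = ≤-antisym (enum-rank-≤ bl 1+j≤J rj)
          (subst (_< rank (enum (suc j))) rj
            (rank-increasing (enum-class j) (enum-class (suc j)) (enum-increasing bl ≤-refl 1+j≤J)))
          where
          rj = enum-rank bl j (<⇒≤ 1+j≤J)

        pow-rank : ∀ k → BelowLength h m (δ k) → rank (pow h k m) ≡ δ k
        pow-rank k bl = subst (λ y → rank y ≡ δ k) (enum-δ k) (enum-rank bl (δ k) ≤-refl)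

        hasRank⇒belowLength : ∀ {j} → HasRank m j → BelowLength h m j
        hasRank⇒belowLength {j} (y , m~y , ry) d 1≤d d≤j per =
          ¬¬-cycle-index (Π⇒part m~y) λ (k , blk , ek) →
            let j≡δk = trans (sym ry) (trans (cong rank (sym ek)) (pow-rank k blk))
            in belowLength-≤ (≤-reflexive j≡δk) blk d 1≤d d≤j per

        period-at-length : ∀ {J} → BelowLength h m J → ¬ HasRank m (suc J) → iter to (suc J) m ≡ m
        period-at-length {J} bl ¬r with anyUpTo? (λ d → (1 ≤? d) ×-dec (iter to d m ≟ m)) (suc (suc J))
        ... | no aperiodic =
          ⊥-elim (¬r (belowLength⇒hasRank λ d 1≤d d≤ per → aperiodic (d , s≤s d≤ , 1≤d , per)))
        ... | yes (d , d<2+J , 1≤d , per) with m≤n⇒m<n∨m≡n (<⇒≤pred d<2+J)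
        ...   | inj₁ d<1+J = ⊥-elim (bl d 1≤d (<⇒≤pred d<1+J) per)
        ...   | inj₂ refl  = per

        even-period : ∀ n → suc (2 * n + 1) ≡ suc n + suc n
        even-period = solve-∀

        odd-period : ∀ n → suc (2 * suc n) ≡ suc n + suc (suc n)
        odd-period = solve-∀

        -- The cases of next (+ n): the cycle is longer than 2n + 2, or has length 2n + 2 or 2n + 1.
        rank-after : ∀ k → BelowLength h m (δ k) → rank (to (pow h k m)) ≡ δ (next m k)
        rank-after (+ n) bl with hasRank? m (δ (+ suc n))
        ... | yes r = pow-rank (+ suc n) (hasRank⇒belowLength r)
        ... | no ¬r₁ with hasRank? m (δ -[1+ n ])
        ...   | yes r₂ = trans (cong rank (iter-to≡iter-from (suc n) (suc n) period))
                               (pow-rank -[1+ n ] (hasRank⇒belowLength r₂))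
          where
          period : iter to (suc n + suc n) m ≡ m
          period = subst (λ p → iter to p m ≡ m) (even-period n)
            (period-at-length (hasRank⇒belowLength r₂)
              (¬r₁ ∘ subst (HasRank m) (sym (δ+[1+n]≡1+δ-[1+n] n))))
        rank-after (+ zero) bl | no _ | no ¬r₂ =
          trans (cong rank (period-at-length (belowLength-≤ z≤n bl) ¬r₂)) r0
        rank-after (+ suc n) bl | no _ | no ¬r₂ =
          trans (cong rank (iter-to≡iter-from (suc n) (suc (suc n)) period))
                (pow-rank -[1+ n ] (belowLength-≤ (δ-[1+n]≤δ+[1+n] n) bl))
          where
          period : iter to (suc n + suc (suc n)) m ≡ m
          period = subst (λ p → iter to p m ≡ m) (odd-period n)
            (period-at-length bl (¬r₂ ∘ subst (HasRank m) (sym (δ-[1+n]≡1+δ+n (suc n)))))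
        rank-after -[1+ zero ]  bl = trans (cong rank (strictlyInverseˡ m)) r0
        rank-after -[1+ suc n ] bl = trans (cong rank (strictlyInverseˡ _))
          (pow-rank -[1+ n ] (belowLength-≤ (δ-[1+n]≤δ-[2+n] n) bl))

      to-class : ∀ x → Π x (to x)
      to-class x = part⇒Π (+ 1 , refl)

      rank-to : ∀ x → rank (to x) ≡ δ (next (base x) (index x))
      rank-to x = decidable-stable (rank (to x) ≟ δ (next (base x) (index x))) (do
        (k , blk , ek) ← ¬¬-cycle-index (Π⇒part (Π-sym (base-class x)))
        let index≡k = index-δ {x} {k} (trans (cong rank (sym ek)) (AtBase.pow-rank (base-rank x) k blk))
        pure (begin
          rank (to x)                  ≡⟨ cong (rank ∘ to) ek ⟨
          rank (to (pow h k (base x))) ≡⟨ AtBase.rank-after (base-rank x) k blk ⟩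
          δ (next (base x) k)          ≡⟨ cong (δ ∘ next (base x)) index≡k ⟨
          δ (next (base x) (index x))  ∎))
        where
        open ≡-Reasoning

≐-refl : (R : Rel ℕ 0ℓ) → R ≐ R
≐-refl R x y = mk⇔ id id

≐-sym : {R S : Rel ℕ 0ℓ} → R ≐ S → S ≐ R
≐-sym R≐S x y = mk⇔ (Equivalence.from (R≐S x y)) (Equivalence.to (R≐S x y))

normal⇒decPermEquiv : (g : Perm) → Normal g → DecPermEquiv (Part g)
normal⇒decPermEquiv g normal = part-isEquivalence , part? normal , g , ≐-refl (Part g)
  where
  open PermProperties g

normal-injective : (g h : Perm) → Normal g → Normal h → Part g ≐ Part h →
                   ∀ x → Inverse.to g x ≡ Inverse.to h x
normal-injective g h g-normal h-normal g≐h x =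
  rank-injective (G.to-class x) (H.to-class x) (trans (G.rank-to x) (sym (H.rank-to x)))
  where
  open PermProperties g using (part-isEquivalence; part?)
  open Ranks (Part g) part-isEquivalence (part? g-normal)
  open Classes g (≐-refl (Part g))
  module G = Uniqueness g g-normal (≐-refl (Part g))
  module H = Uniqueness h h-normal (≐-sym g≐h)

decPermEquiv⇒normal : (Π : Rel ℕ 0ℓ) → DecPermEquiv Π → ∃[ g ] (Normal g × Part g ≐ Π)
decPermEquiv⇒normal Π (isEquivalence , Π? , f , f-part) = G , G-normal , G-part
  where
  open Ranks Π isEquivalence Π?
  open Classes f f-part

theorem3p16 : ((g : Perm) → Normal g → DecPermEquiv (Part g))
    × ((g h : Perm) → Normal g → Normal h → Part g ≐ Part h → ∀ x → Inverse.to g x ≡ Inverse.to h x)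
    × ((Π : Rel ℕ _) → DecPermEquiv Π → ∃[ g ] (Normal g × Part g ≐ Π))
theorem3p16 = normal⇒decPermEquiv , normal-injective , decPermEquiv⇒normal
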